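{- Let $M$ be a real $n\times n$ Z-matrix. Then $M$ is a quasi non-singular $M$-matrix if and only if \[ \det(M+D)>\det(M+D')>\det(M) \] for all real diagonal matrices $D,D'$ with $D>D'>0$.
   Context: A real square matrix $M=(m_{ij})$ is a Z-matrix if $m_{ij}\le 0$ for all $i\ne j$. A real Z-matrix is a quasi non-singular $M$-matrix if all its proper principal minors (principal minors indexed by proper subsets of the index set) are positive. For real matrices (or vectors) the partial order is entrywise: $A\le B$ iff $a_{ij}\le b_{ij}$ for all entries, and $A<B$ iff $A\le B$ and $A\neq B$. Thus $D>D'>0$ means $D'\ge 0$ entrywise with $D'\neq 0$, and $D\ge D'$ entrywise with $D\neq D'$. -}

module Defs where

open import Level using (0ℓ)
open import Data.Nat as ℕ using (ℕ; zero; suc)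
open import Data.Fin as Fin using (Fin; zero; suc; punchIn; toℕ)
open import Data.Product using (Σ; ∃; _×_; _,_)
open import Data.Sum using (_⊎_)
open import Data.Bool using (if_then_else_)
open import Relation.Nullary using (¬_)
open import Relation.Binary.PropositionalEquality using (_≡_)
open import Relation.Binary.Structures using (IsStrictTotalOrder)
open import Algebra.Structures using (IsCommutativeRing)
open import Function.Bundles using (_⇔_)

-- The real numbers, axiomatised as a Dedekind-complete ordered field
-- (unique up to isomorphism).  Equality is propositional equality.

record RealField : Set₁ where
  infixl 6 _+_
  infixl 7 _*_
  infix  4 _<_ _≤_
  field
    ℝ   : Set
    _+_ : ℝ → ℝ → ℝ
    _*_ : ℝ → ℝ → ℝ
    -_  : ℝ → ℝ
    0#  : ℝ
    1#  : ℝ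
    isCommutativeRing : IsCommutativeRing _≡_ _+_ _*_ -_ 0# 1#
    0≢1  : ¬ (0# ≡ 1#)
    inv  : (x : ℝ) → ¬ (x ≡ 0#) → ℝ
    inv-inverse : (x : ℝ) (p : ¬ (x ≡ 0#)) → x * inv x p ≡ 1#
    _<_ : ℝ → ℝ → Set
    <-isStrictTotalOrder : IsStrictTotalOrder _≡_ _<_
    +-mono-< : ∀ {x y} (z : ℝ) → x < y → x + z < y + z
    *-pos    : ∀ {x y} → 0# < x → 0# < y → 0# < x * y

  _≤_ : ℝ → ℝ → Set
  x ≤ y = x < y ⊎ x ≡ y

  field
    complete : (P : ℝ → Set) → ∃ P → (∃ λ b → ∀ x → P x → x ≤ b) →
               ∃ λ s → (∀ x → P x → x ≤ s) ×
                       (∀ b → (∀ x → P x → x ≤ b) → s ≤ b)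

module _ (R : RealField) where
  open RealField R

  Mat : ℕ → Set
  Mat n = Fin n → Fin n → ℝ

  sumFin : ∀ {n} → (Fin n → ℝ) → ℝ
  sumFin {zero}  f = 0#
  sumFin {suc n} f = f zero + sumFin (λ i → f (suc i))

  sgn : ℕ → ℝ
  sgn zero    = 1#
  sgn (suc k) = - sgn k

  det : ∀ {n} → Mat n → ℝ
  det {zero}  M = 1#
  det {suc n} M =
    sumFin (λ j → sgn (toℕ j) * M zero j * det (λ i k → M (suc i) (punchIn j k)))

  _+M_ : ∀ {n} → Mat n → Mat n → Mat n
  (A +M B) i j = A i j + B i j

  0M : ∀ {n} → Mat n
  0M i j = 0#

  _≤M_ : ∀ {n} → Mat n → Mat n → Set
  A ≤M B = ∀ i j → A i j ≤ B i j

  _<M_ : ∀ {n} → Mat n → Mat n → Set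
  A <M B = A ≤M B × ¬ (∀ i j → A i j ≡ B i j)

  IsDiagonal : ∀ {n} → Mat n → Set
  IsDiagonal D = ∀ i j → ¬ (i ≡ j) → D i j ≡ 0#

  IsZMatrix : ∀ {n} → Mat n → Set
  IsZMatrix M = ∀ i j → ¬ (i ≡ j) → M i j ≤ 0#

  -- principal submatrix on the index set {σ 0 < σ 1 < … < σ (k-1)}
  principalSub : ∀ {n k} → Mat n → (Fin k → Fin n) → Mat k
  principalSub M σ a b = M (σ a) (σ b)

  StrictlyIncreasing : ∀ {n k} → (Fin k → Fin n) → Set
  StrictlyIncreasing σ = ∀ a b → a Fin.< b → σ a Fin.< σ b

  IsQuasiNonsingularMMatrix : ∀ {n} → Mat n → Set
  IsQuasiNonsingularMMatrix {n} M =
    IsZMatrix M ×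
    (∀ k → k ℕ.< n → (σ : Fin k → Fin n) → StrictlyIncreasing σ →
       0# < det (principalSub M σ))

{-# OPTIONS --safe #-}

-- Expanding along row j shows that det (M + diag d) is affine in each d j, with slope
-- det (M[j] + diag d[j]), where [j] deletes the index j. Hence strict monotonicity on
-- d ≥ 0 amounts to: det (M[j] + diag d) > 0 for all j and all d ≥ 0. This follows from
-- positive proper principal minors by induction on the size. Conversely, let N = M[j].
-- Letting the entries of d tend to infinity, all principal minors of N are ≥ 0; then, N
-- being a Z-matrix, its signed cofactors are ≥ 0 (induction, expanding along one row). If some
-- det N[i] were 0, the expansion of det N along row i would have only terms ≤ 0, although
-- det N > 0. So det N[i] > 0, and the argument repeats with N[i].
module Submission where

open import Defs
open import Level using (0ℓ)
open import Data.Nat as ℕ using (ℕ; zero; suc)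
open import Data.Nat.Properties as ℕ using ()
open import Data.Fin as Fin using (Fin; zero; suc; punchIn; punchOut; toℕ; _≟_)
open import Data.Fin.Properties
  using (punchIn-injective; punchInᵢ≢i; punchIn-punchOut; punchIn-cancel-≤; punchIn-mono-≤;
         toℕ-injective; injective⇒≤; <-cmp; ¬∀⟶∃¬; all?)
open import Data.Vec.Functional using (_∷_; insertAt; tail)
open import Data.Vec.Functional.Properties using (insertAt-lookup; insertAt-punchIn)
open import Data.Bool using (if_then_else_)
open import Data.Product using (Σ; ∃; _×_; _,_; proj₁; proj₂)
open import Data.Sum using (_⊎_; inj₁; inj₂)
open import Relation.Nullary using (¬_; yes; no; does; contradiction)
open import Relation.Nullary.Decidable using (dec-true; dec-false)
open import Relation.Binary.Definitions using (tri<; tri≈; tri>)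
open import Relation.Binary.Structures using (IsStrictTotalOrder)
open import Relation.Binary.PropositionalEquality
open import Algebra.Bundles using (CommutativeRing)
open import Function using (_∘_)
open import Function.Bundles using (_⇔_; mk⇔)
import Relation.Binary.Construct.StrictToNonStrict as StrictToNonStrict
import Algebra.Properties.Ring as RingProperties
import Algebra.Solver.Ring.NaturalCoefficients.Default as SemiringSolver

-- Deleting two indices in either order

-- The position of c among the indices other than punchIn c l.
other : ∀ {n} → Fin (suc n) → Fin n → Fin n
other {suc n} zero    l       = zero
other {suc n} (suc c) zero    = c
other {suc n} (suc c) (suc l) = suc (other c l)

punchIn-other : ∀ {n} (c : Fin (suc n)) (l : Fin n) →
  punchIn (punchIn c l) (other c l) ≡ c
punchIn-other {suc n} zero    l       = refl
punchIn-other {suc n} (suc c) zero    = refl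
punchIn-other {suc n} (suc c) (suc l) = cong suc (punchIn-other c l)

-- Deleting two indices leaves the same remaining ones whichever goes first, so a minor of a minor
-- does not depend on the order of deletion.
punchIn-punchIn-other : ∀ {n} (c : Fin (suc (suc n))) (l : Fin (suc n)) (x : Fin n) →
  punchIn (punchIn c l) (punchIn (other c l) x) ≡ punchIn c (punchIn l x)
punchIn-punchIn-other zero    l       x       = refl
punchIn-punchIn-other (suc c) zero    x       = refl
punchIn-punchIn-other (suc c) (suc l) zero    = refl
punchIn-punchIn-other (suc c) (suc l) (suc x) = cong suc (punchIn-punchIn-other c l x)

module _ (R : RealField) where
  open RealField R

  private
    commutativeRing : CommutativeRing 0ℓ 0ℓ
    commutativeRing = record { isCommutativeRing = isCommutativeRing }

    open CommutativeRing commutativeRing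
      using (ring; +-identityˡ; +-identityʳ; +-comm; +-assoc; *-identityˡ; *-identityʳ; *-comm; *-assoc;
             zeroˡ; zeroʳ; -‿inverseʳ; -‿inverseˡ; distribˡ; distribʳ)
    open RingProperties ring
      using (-‿distribˡ-*; -‿distribʳ-*; -‿involutive; -0#≈0#)
    open IsStrictTotalOrder <-isStrictTotalOrder
      using (compare; <-resp-≈) renaming (trans to <-trans; irrefl to <-irrefl; _≟_ to _≟ᵣ_)

    open SemiringSolver (CommutativeRing.commutativeSemiring commutativeRing)
      using (solve; _:=_; _:+_; _:*_; con)

    module ≤ = StrictToNonStrict _≡_ _<_

  -- Arithmetic of the ordered field

  ≤-refl : ∀ {x} → x ≤ x
  ≤-refl = inj₂ refl

  ≤-trans : ∀ {x y z} → x ≤ y → y ≤ z → x ≤ z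
  ≤-trans = ≤.trans isEquivalence <-resp-≈ <-trans

  <-≤-trans : ∀ {x y z} → x < y → y ≤ z → x < z
  <-≤-trans = ≤.<-≤-trans <-trans (proj₁ <-resp-≈)

  <⇒≱ : ∀ {x y} → x < y → ¬ (y ≤ x)
  <⇒≱ x<y y≤x = <-irrefl refl (<-≤-trans x<y y≤x)

  ≮⇒≥ : ∀ {x y} → ¬ (x < y) → y ≤ x
  ≮⇒≥ {x} {y} x≮y with compare x y
  ... | tri< x<y _ _ = contradiction x<y x≮y
  ... | tri≈ _ x≡y _ = inj₂ (sym x≡y)
  ... | tri> _ _ y<x = inj₁ y<x

  +-monoʳ-< : ∀ x {y z} → y < z → x + y < x + z
  +-monoʳ-< x y<z = subst₂ _<_ (+-comm _ _) (+-comm _ _) (+-mono-< x y<z)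

  +-monoʳ-≤ : ∀ x {y z} → y ≤ z → x + y ≤ x + z
  +-monoʳ-≤ x (inj₁ y<z) = inj₁ (+-monoʳ-< x y<z)
  +-monoʳ-≤ x (inj₂ y≡z) = inj₂ (cong (x +_) y≡z)

  x<x+y : ∀ x {y} → 0# < y → x < x + y
  x<x+y x {y} 0<y = subst (_< x + y) (+-identityʳ x) (+-monoʳ-< x 0<y)

  x≤x+y : ∀ x {y} → 0# ≤ y → x ≤ x + y
  x≤x+y x {y} 0≤y = subst (_≤ x + y) (+-identityʳ x) (+-monoʳ-≤ x 0≤y)

  +-nonneg : ∀ {x y} → 0# ≤ x → 0# ≤ y → 0# ≤ x + y
  +-nonneg {x} 0≤x 0≤y = ≤-trans 0≤x (x≤x+y x 0≤y)

  *-nonneg : ∀ {x y} → 0# ≤ x → 0# ≤ y → 0# ≤ x * y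
  *-nonneg {x} {y} (inj₁ 0<x) (inj₁ 0<y) = inj₁ (*-pos 0<x 0<y)
  *-nonneg {x} {y} (inj₂ 0≡x) _          = inj₂ (sym (trans (cong (_* y) (sym 0≡x)) (zeroˡ y)))
  *-nonneg {x} {y} (inj₁ _)   (inj₂ 0≡y) = inj₂ (sym (trans (cong (x *_) (sym 0≡y)) (zeroʳ x)))

  neg-pos : ∀ {x} → x < 0# → 0# < - x
  neg-pos {x} x<0 = subst₂ _<_ (-‿inverseʳ x) (+-identityˡ (- x)) (+-mono-< (- x) x<0)

  neg-nonneg : ∀ {x} → x ≤ 0# → 0# ≤ - x
  neg-nonneg (inj₁ x<0) = inj₁ (neg-pos x<0)
  neg-nonneg (inj₂ x≡0) = inj₂ (sym (trans (cong -_ x≡0) -0#≈0#))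

  neg-*-neg : ∀ x y → - x * - y ≡ x * y
  neg-*-neg x y = begin
    - x * - y     ≡⟨ -‿distribˡ-* x (- y) ⟨
    - (x * - y)   ≡⟨ cong -_ (-‿distribʳ-* x y) ⟨
    - (- (x * y)) ≡⟨ -‿involutive (x * y) ⟩
    x * y         ∎
    where open ≡-Reasoning

  0<1 : 0# < 1#
  0<1 with compare 0# 1#
  ... | tri< 0<1 _ _ = 0<1
  ... | tri≈ _ 0≡1 _ = contradiction 0≡1 0≢1
  ... | tri> _ _ 1<0 = subst (0# <_) (trans (neg-*-neg 1# 1#) (*-identityˡ 1#))
                         (*-pos (neg-pos 1<0) (neg-pos 1<0))

  pos⇒neg<0 : ∀ {x} → 0# < x → - x < 0#
  pos⇒neg<0 {x} 0<x = subst₂ _<_ (+-identityˡ (- x)) (-‿inverseʳ x) (+-mono-< (- x) 0<x)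

  -1<0 : - 1# < 0#
  -1<0 = pos⇒neg<0 0<1

  *-nonposˡ : ∀ {x y} → x ≤ 0# → 0# ≤ y → 0# ≤ - (x * y)
  *-nonposˡ {x} {y} x≤0 0≤y = subst (0# ≤_) (sym (-‿distribˡ-* x y)) (*-nonneg (neg-nonneg x≤0) 0≤y)

  >0⇒≢0 : ∀ {x} → 0# < x → ¬ (x ≡ 0#)
  >0⇒≢0 0<x x≡0 = <-irrefl (sym x≡0) 0<x

  inv-pos : ∀ {x} (0<x : 0# < x) → 0# < inv x (>0⇒≢0 0<x)
  inv-pos {x} 0<x with compare 0# (inv x (>0⇒≢0 0<x))
  ... | tri< 0<i _ _ = 0<i
  ... | tri≈ _ 0≡i _ = contradiction (trans (sym (zeroʳ x)) (trans (cong (x *_) 0≡i) (inv-inverse x _))) 0≢1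
  ... | tri> _ _ i<0 = contradiction
        (subst (0# ≤_) (cong -_ (trans (*-comm _ x) (inv-inverse x _))) (*-nonposˡ (inj₁ i<0) (inj₁ 0<x)))
        (<⇒≱ -1<0)

  -- A line of negative slope eventually drops below zero. This takes the place of a limit as a
  -- diagonal entry tends to infinity.
  affine-nonneg⇒slope-nonneg : ∀ a b → (∀ t → 0# ≤ t → 0# ≤ a + t * b) → 0# ≤ b
  affine-nonneg⇒slope-nonneg a b h = ≮⇒≥ impossible
    where
    open ≡-Reasoning
    0≤a : 0# ≤ a
    0≤a = subst (0# ≤_) (trans (cong (a +_) (zeroˡ b)) (+-identityʳ a)) (h 0# ≤-refl)
    impossible : ¬ (b < 0#)
    impossible b<0 = <⇒≱ -1<0 (subst (0# ≤_) value (h t (*-nonneg (+-nonneg 0≤a (inj₁ 0<1)) (inj₁ (inv-pos 0<-b)))))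
      where
      0<-b = neg-pos b<0
      i = inv (- b) (>0⇒≢0 0<-b)
      -- Solves `a + t * b ≡ - 1#`. It is nonnegative because `0≤a`, the hypothesis at zero.
      t = (a + 1#) * i
      i*b : i * b ≡ - 1#
      i*b = begin
        i * b         ≡⟨ cong (i *_) (-‿involutive b) ⟨
        i * - (- b)   ≡⟨ -‿distribʳ-* i (- b) ⟨
        - (i * - b)   ≡⟨ cong -_ (*-comm i (- b)) ⟩
        - (- b * i)   ≡⟨ cong -_ (inv-inverse (- b) _) ⟩
        - 1#          ∎
      value : a + t * b ≡ - 1#
      value = begin
        a + (a + 1#) * i * b              ≡⟨ cong (a +_) (*-assoc (a + 1#) i b) ⟩
        a + (a + 1#) * (i * b)            ≡⟨ cong (λ z → a + (a + 1#) * z) i*b ⟩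
        a + (a + 1#) * - 1#               ≡⟨ cong (a +_) (distribʳ (- 1#) a 1#) ⟩
        a + (a * - 1# + 1# * - 1#)        ≡⟨ cong₂ (λ y z → a + (y + z))
                                               (trans (sym (-‿distribʳ-* a 1#)) (cong -_ (*-identityʳ a))) (*-identityˡ _) ⟩
        a + (- a + - 1#)                  ≡⟨ +-assoc a (- a) (- 1#) ⟨
        a + - a + - 1#                    ≡⟨ cong (_+ - 1#) (-‿inverseʳ a) ⟩
        0# + - 1#                         ≡⟨ +-identityˡ _ ⟩
        - 1#                              ∎

  -- Finite sums

  private
    Σ[_] : ∀ {n} → (Fin n → ℝ) → ℝ
    Σ[_] = sumFin R

  sum-cong : ∀ {n} {f g : Fin n → ℝ} → f ≗ g → Σ[ f ] ≡ Σ[ g ]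
  sum-cong {zero}  f≗g = refl
  sum-cong {suc n} f≗g = cong₂ _+_ (f≗g zero) (sum-cong (f≗g ∘ suc))

  +-interchange : ∀ a b c d → (a + b) + (c + d) ≡ (a + c) + (b + d)
  +-interchange = solve 4 (λ a b c d → (a :+ b) :+ (c :+ d) := (a :+ c) :+ (b :+ d)) refl

  +-swap : ∀ a b c → a + (b + c) ≡ b + (a + c)
  +-swap = solve 3 (λ a b c → a :+ (b :+ c) := b :+ (a :+ c)) refl

  sum-+ : ∀ {n} (f g : Fin n → ℝ) → Σ[ (λ i → f i + g i) ] ≡ Σ[ f ] + Σ[ g ]
  sum-+ {zero}  f g = sym (+-identityʳ 0#)
  sum-+ {suc n} f g =
    trans (cong (f zero + g zero +_) (sum-+ (f ∘ suc) (g ∘ suc)))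
          (+-interchange (f zero) (g zero) _ _)

  *-sum : ∀ {n} a (f : Fin n → ℝ) → a * Σ[ f ] ≡ Σ[ (λ i → a * f i) ]
  *-sum {zero}  a f = zeroʳ a
  *-sum {suc n} a f = trans (distribˡ a _ _) (cong (a * f zero +_) (*-sum a (f ∘ suc)))

  neg-sum : ∀ {n} (f : Fin n → ℝ) → - Σ[ f ] ≡ Σ[ (λ i → - f i) ]
  neg-sum f = begin
    - Σ[ f ]                  ≡⟨ neg-1 _ ⟩
    - 1# * Σ[ f ]             ≡⟨ *-sum (- 1#) f ⟩
    Σ[ (λ i → - 1# * f i) ]   ≡⟨ sum-cong (λ i → neg-1 (f i)) ⟨
    Σ[ (λ i → - f i) ]        ∎
    where
    open ≡-Reasoning
    neg-1 : ∀ x → - x ≡ - 1# * x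
    neg-1 x = trans (cong -_ (sym (*-identityˡ x))) (-‿distribˡ-* 1# x)

  sum-nonneg : ∀ {n} {f : Fin n → ℝ} → (∀ i → 0# ≤ f i) → 0# ≤ Σ[ f ]
  sum-nonneg {zero}  0≤f = ≤-refl
  sum-nonneg {suc n} 0≤f = +-nonneg (0≤f zero) (sum-nonneg (0≤f ∘ suc))

  sum-punchIn : ∀ {n} (i : Fin (suc n)) (f : Fin (suc n) → ℝ) →
    Σ[ f ] ≡ f i + Σ[ f ∘ punchIn i ]
  sum-punchIn         zero    f = refl
  sum-punchIn {suc n} (suc i) f =
    trans (cong (f zero +_) (sum-punchIn i (f ∘ suc))) (+-swap (f zero) (f (suc i)) _)

  -- Both sides run over the ordered pairs of distinct indices (j , punchIn j k) = (punchIn c l , c).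
  sum-other : ∀ {n} (G : Fin (suc n) → Fin n → ℝ) →
    Σ[ (λ j → Σ[ G j ]) ] ≡ Σ[ (λ c → Σ[ (λ l → G (punchIn c l) (other c l)) ]) ]
  sum-other {zero}  G = refl
  sum-other {suc n} G = begin
    G₀ + Σ[ (λ j → G (suc j) zero + Σ[ (λ k → G (suc j) (suc k)) ]) ]
      ≡⟨ cong (G₀ +_) (sum-+ (λ j → G (suc j) zero) (λ j → Σ[ (λ k → G (suc j) (suc k)) ])) ⟩
    G₀ + (G₁ + Σ[ (λ j → Σ[ (λ k → G (suc j) (suc k)) ]) ])
      ≡⟨ cong (λ z → G₀ + (G₁ + z)) (sum-other (λ j k → G (suc j) (suc k))) ⟩
    G₀ + (G₁ + _)
      ≡⟨ +-swap G₀ G₁ _ ⟩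
    G₁ + (G₀ + _)
      ≡⟨ cong (G₁ +_) (sum-+ (G zero) (λ c → Σ[ (λ l → G (suc (punchIn c l)) (suc (other c l))) ])) ⟨
    _ ∎
    where
    open ≡-Reasoning
    G₀ = Σ[ G zero ]
    G₁ = Σ[ (λ j → G (suc j) zero) ]

  -- Laplace expansion along an arbitrary row

  sg : ∀ {n} → Fin n → ℝ
  sg i = sgn R (toℕ i)

  sg-square : ∀ {n} (i : Fin n) → sg i * sg i ≡ 1#
  sg-square zero    = *-identityˡ 1#
  sg-square (suc i) = trans (neg-*-neg _ _) (sg-square i)

  -- When the order of deletion is exchanged, exactly one of the two positions shifts by one, whence
  -- the change of sign.
  sg-other : ∀ {n} (c : Fin (suc n)) (l : Fin n) →
    sg (punchIn c l) * sg (other c l) ≡ - (sg c * sg l)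
  sg-other {suc n} zero    l       = trans (*-identityʳ _) (cong -_ (sym (*-identityˡ _)))
  sg-other {suc n} (suc c) zero    = begin
    1# * sg c       ≡⟨ *-comm 1# (sg c) ⟩
    sg c * 1#       ≡⟨ -‿involutive _ ⟨
    - - (sg c * 1#) ≡⟨ cong -_ (-‿distribˡ-* (sg c) 1#) ⟩
    - (- sg c * 1#) ∎
    where open ≡-Reasoning
  sg-other {suc n} (suc c) (suc l) =
    trans (neg-*-neg _ _) (trans (sg-other c l) (cong -_ (sym (neg-*-neg _ _))))

  minor : ∀ {n} → Fin (suc n) → Fin (suc n) → Mat R (suc n) → Mat R n
  minor r c A i k = A (punchIn r i) (punchIn c k)

  det-cong : ∀ {n} {A B : Mat R n} → (∀ i k → A i k ≡ B i k) → det R A ≡ det R B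
  det-cong {zero}  A≗B = refl
  det-cong {suc n} A≗B = sum-cong λ j →
    cong₂ (λ a d → sg j * a * d) (A≗B zero j) (det-cong (λ i k → A≗B (suc i) (punchIn j k)))

  cofactor : ∀ {n} → Mat R (suc n) → Fin (suc n) → Fin (suc n) → ℝ
  cofactor A r c = sg r * sg c * det R (minor r c A)

  -- Row `zero` is the definition. For a later row, expand along row `zero` and each minor along row
  -- `r`; this sums over ordered pairs of distinct columns. Exchanging the pair with `sum-other`
  -- costs a sign, which turns `sg r` into `sg (suc r)`.
  det-expand : ∀ {n} (A : Mat R (suc n)) r → det R A ≡ Σ[ (λ c → A r c * cofactor A r c) ]
  det-expand A zero = sum-cong λ c → rearrange (sg c) (A zero c) (det R (minor zero c A))
    where
    rearrange : ∀ s a d → s * a * d ≡ a * (1# * s * d)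
    rearrange = solve 3 (λ s a d → s :* a :* d := a :* (con 1 :* s :* d)) refl
  det-expand {suc n} A (suc r) = begin
    Σ[ (λ j → sg j * A zero j * det R (minor zero j A)) ]
      ≡⟨ sum-cong (λ j → trans (cong (sg j * A zero j *_) (det-expand (minor zero j A) r))
           (*-sum {suc n} (sg j * A zero j) (λ k → minor zero j A r k * cofactor (minor zero j A) r k))) ⟩
    Σ[ (λ j → Σ[ G j ]) ]
      ≡⟨ sum-other G ⟩
    Σ[ (λ c → Σ[ (λ l → G (punchIn c l) (other c l)) ]) ]
      -- The first row of `minor (suc r) c A` comes from row `zero` of `A`, so the inner sum is the
      -- defining expansion of its determinant.
      ≡⟨ sum-cong (λ c → trans (sum-cong (term c)) (sym
           (trans (sym (*-assoc (A (suc r) c) (sg (suc r) * sg c) _))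
             (*-sum {suc n} (A (suc r) c * (sg (suc r) * sg c))
               (λ l → sg l * A zero (punchIn c l) * det R (minor zero l (minor (suc r) c A))))))) ⟩
    Σ[ (λ c → A (suc r) c * cofactor A (suc r) c) ] ∎
    where
    open ≡-Reasoning
    G : Fin (suc (suc n)) → Fin (suc n) → ℝ
    G j k = sg j * A zero j * (minor zero j A r k * cofactor (minor zero j A) r k)
    rearrange : ∀ s a b u v d → s * a * (b * (u * v * d)) ≡ (s * v) * (u * (a * b * d))
    rearrange = solve 6 (λ s a b u v d → s :* a :* (b :* (u :* v :* d)) := (s :* v) :* (u :* (a :* b :* d))) refl
    rearrange′ : ∀ x y a b u d → x * y * (u * (a * b * d)) ≡ b * (u * x) * (y * a * d)
    rearrange′ = solve 6 (λ x y a b u d → x :* y :* (u :* (a :* b :* d)) := b :* (u :* x) :* (y :* a :* d)) refl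
    term : ∀ c l → G (punchIn c l) (other c l) ≡
      A (suc r) c * (sg (suc r) * sg c) * (sg l * A zero (punchIn c l) * det R (minor zero l (minor (suc r) c A)))
    term c l = begin
      sg j * A zero j * (A (suc r) (punchIn j k) * (sg r * sg k * det R (minor r k (minor zero j A))))
        ≡⟨ cong₂ (λ x y → sg j * A zero j * (A (suc r) x * (sg r * sg k * y))) (punchIn-other c l)
             (det-cong (λ i m → cong (A (suc (punchIn r i))) (punchIn-punchIn-other c l m))) ⟩
      sg j * A zero j * (A (suc r) c * (sg r * sg k * d))
        ≡⟨ rearrange (sg j) (A zero j) (A (suc r) c) (sg r) (sg k) d ⟩
      sg j * sg k * (sg r * (A zero j * A (suc r) c * d))
        ≡⟨ cong (_* (sg r * (A zero j * A (suc r) c * d))) (sg-other c l) ⟩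
      - (sg c * sg l) * (sg r * (A zero j * A (suc r) c * d))
        ≡⟨ trans (sym (-‿distribˡ-* (sg c * sg l) _)) (-‿distribʳ-* (sg c * sg l) _) ⟩
      sg c * sg l * - (sg r * (A zero j * A (suc r) c * d))
        ≡⟨ cong (sg c * sg l *_) (-‿distribˡ-* (sg r) _) ⟩
      sg c * sg l * (- sg r * (A zero j * A (suc r) c * d))
        ≡⟨ rearrange′ (sg c) (sg l) (A zero j) (A (suc r) c) (- sg r) d ⟩
      A (suc r) c * (- sg r * sg c) * (sg l * A zero j * d) ∎
      where
      j = punchIn c l
      k = other c l
      d = det R (minor zero l (minor (suc r) c A))

  cofactor-diagonal : ∀ {n} (A : Mat R (suc n)) r → cofactor A r r ≡ det R (minor r r A)
  cofactor-diagonal A r = trans (cong (_* det R (minor r r A)) (sg-square r)) (*-identityˡ _)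

  -- Isolates the only term of the expansion along row `r` that involves the diagonal entry `A r r`.
  det-expand-diagonal : ∀ {n} (A : Mat R (suc n)) r →
    det R A ≡ A r r * det R (minor r r A) +
              Σ[ (λ l → A r (punchIn r l) * cofactor A r (punchIn r l)) ]
  det-expand-diagonal A r = begin
    det R A                                   ≡⟨ det-expand A r ⟩
    Σ[ (λ c → A r c * cofactor A r c) ]       ≡⟨ sum-punchIn r (λ c → A r c * cofactor A r c) ⟩
    A r r * cofactor A r r + S                ≡⟨ cong (λ z → A r r * z + S) (cofactor-diagonal A r) ⟩
    A r r * det R (minor r r A) + S           ∎
    where
    open ≡-Reasoning
    S = Σ[ (λ l → A r (punchIn r l) * cofactor A r (punchIn r l)) ]

  -- Diagonal perturbations

  -- A diagonal perturbation is carried as the vector of its entries, so that it can be restricted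
  -- by `punchIn` and extended by `insertAt`.
  diag : ∀ {n} → (Fin n → ℝ) → Mat R n
  diag d i k = if does (i ≟ k) then d i else 0#

  diag-≡ : ∀ {n} (d : Fin n → ℝ) i → diag d i i ≡ d i
  diag-≡ d i = cong (if_then d i else 0#) (dec-true (i ≟ i) refl)

  diag-≢ : ∀ {n} (d : Fin n → ℝ) {i k} → ¬ (i ≡ k) → diag d i k ≡ 0#
  diag-≢ d {i} {k} i≢k = cong (if_then d i else 0#) (dec-false (i ≟ k) i≢k)

  diag-cong : ∀ {n} (d e : Fin n → ℝ) i → d i ≡ e i → ∀ k → diag d i k ≡ diag e i k
  diag-cong d e i dᵢ≡eᵢ k = cong (if does (i ≟ k) then_else 0#) dᵢ≡eᵢ

  diag-zero : ∀ {n} (i k : Fin n) → diag (λ _ → 0#) i k ≡ 0#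
  diag-zero i k with i ≟ k
  ... | yes _ = refl
  ... | no  _ = refl

  diag-punchIn : ∀ {n} (d : Fin (suc n) → ℝ) j i k →
    diag d (punchIn j i) (punchIn j k) ≡ diag (d ∘ punchIn j) i k
  diag-punchIn d j i k with i ≟ k
  ... | yes refl = diag-≡ d (punchIn j i)
  ... | no i≢k   = diag-≢ d (i≢k ∘ punchIn-injective j i k)

  IsDiagonal⇒≡diag : ∀ {n} {D : Mat R n} → IsDiagonal R D → ∀ i k → D i k ≡ diag (λ a → D a a) i k
  IsDiagonal⇒≡diag D-diag i k with i ≟ k
  ... | yes refl = refl
  ... | no i≢k   = D-diag i k i≢k

  infixl 6 _⊕_
  _⊕_ : ∀ {n} → Mat R n → (Fin n → ℝ) → Mat R n
  A ⊕ d = _+M_ R A (diag d)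

  det-⊕-cong : ∀ {n} (A : Mat R n) {d e : Fin n → ℝ} → d ≗ e → det R (A ⊕ d) ≡ det R (A ⊕ e)
  det-⊕-cong A {d} {e} d≗e = det-cong λ i k → cong (A i k +_) (diag-cong d e i (d≗e i) k)

  det-⊕-zero : ∀ {n} (A : Mat R n) → det R (A ⊕ λ _ → 0#) ≡ det R A
  det-⊕-zero A = det-cong λ i k → trans (cong (A i k +_) (diag-zero i k)) (+-identityʳ _)

  -- Only the diagonal entry of row `j` changes, and the cofactors along row `j` do not see that
  -- row. The expansion is therefore affine in this entry, with the complementary principal minor as
  -- slope.
  det-⊕-shift : ∀ {n} (A : Mat R (suc n)) j (d e : Fin (suc n) → ℝ) t →
    e j ≡ d j + t → (∀ i → e (punchIn j i) ≡ d (punchIn j i)) →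
    det R (A ⊕ e) ≡ det R (A ⊕ d) + t * det R (minor j j A ⊕ (d ∘ punchIn j))
  det-⊕-shift {n} A j d e t eⱼ≡dⱼ+t e≗d = begin
    det R (A ⊕ e)
      ≡⟨ det-expand-diagonal (A ⊕ e) j ⟩
    (A ⊕ e) j j * det R (minor j j (A ⊕ e)) + S e
      ≡⟨ cong₂ _+_ (cong₂ _*_ pivot (minors j)) (sum-cong {n} offDiagonal) ⟩
    (A j j + (diag d j j + t)) * det R (minor j j (A ⊕ d)) + S d
      ≡⟨ rearrange (A j j) (diag d j j) t (det R (minor j j (A ⊕ d))) (S d) ⟩
    (A ⊕ d) j j * det R (minor j j (A ⊕ d)) + S d + t * det R (minor j j (A ⊕ d))
      ≡⟨ cong₂ (λ x y → x + t * y) (sym (det-expand-diagonal (A ⊕ d) j))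
           (det-cong (λ i k → cong (A (punchIn j i) (punchIn j k) +_) (diag-punchIn d j i k))) ⟩
    det R (A ⊕ d) + t * det R (minor j j A ⊕ (d ∘ punchIn j)) ∎
    where
    open ≡-Reasoning
    S : (Fin (suc n) → ℝ) → ℝ
    S f = Σ[ (λ l → (A ⊕ f) j (punchIn j l) * cofactor (A ⊕ f) j (punchIn j l)) ]
    minors : ∀ c → det R (minor j c (A ⊕ e)) ≡ det R (minor j c (A ⊕ d))
    minors c = det-cong λ i k → cong (A (punchIn j i) (punchIn c k) +_) (diag-cong e d (punchIn j i) (e≗d i) (punchIn c k))
    pivot : (A ⊕ e) j j ≡ A j j + (diag d j j + t)
    pivot = cong (A j j +_) (trans (diag-≡ e j) (trans eⱼ≡dⱼ+t (cong (_+ t) (sym (diag-≡ d j)))))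
    offDiagonal : ∀ l → (A ⊕ e) j (punchIn j l) * cofactor (A ⊕ e) j (punchIn j l)
                      ≡ (A ⊕ d) j (punchIn j l) * cofactor (A ⊕ d) j (punchIn j l)
    offDiagonal l = cong₂ (λ x y → (A j (punchIn j l) + x) * (sg j * sg (punchIn j l) * y))
      (trans (diag-≢ e j≢) (sym (diag-≢ d j≢))) (minors (punchIn j l))
      where j≢ = punchInᵢ≢i j l ∘ sym
    rearrange : ∀ a x t m s → (a + (x + t)) * m + s ≡ (a + x) * m + s + t * m
    rearrange = solve 5 (λ a x t m s → (a :+ (x :+ t)) :* m :+ s := (a :+ x) :* m :+ s :+ t :* m) refl

  -- The affine law with entry `j` as a free variable `t`: any perturbation `d` of the minor arises
  -- in this way as part of one of `A`.
  det-⊕-insertAt : ∀ {n} (A : Mat R (suc n)) j (d : Fin n → ℝ) t →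
    det R (A ⊕ insertAt d j t) ≡ det R (A ⊕ insertAt d j 0#) + t * det R (minor j j A ⊕ d)
  det-⊕-insertAt A j d t = trans
    (det-⊕-shift A j (insertAt d j 0#) (insertAt d j t) t
      (trans (insertAt-lookup d j t) (sym (trans (cong (_+ t) (insertAt-lookup d j 0#)) (+-identityˡ t))))
      (λ i → trans (insertAt-punchIn d j t i) (sym (insertAt-punchIn d j 0# i))))
    (cong (λ z → det R (A ⊕ insertAt d j 0#) + t * z)
      (det-⊕-cong (minor j j A) (insertAt-punchIn d j 0#)))

  -- Monotonicity of the determinant in the diagonal

  Nonneg : ∀ {n} → (Fin n → ℝ) → Set
  Nonneg d = ∀ i → 0# ≤ d i

  punchIn-cases : ∀ {n} (j : Fin (suc n)) {p} {P : Fin (suc n) → Set p} →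
    P j → (∀ i → P (punchIn j i)) → ∀ i → P i
  punchIn-cases j {P = P} Pj P-punchIn i with j ≟ i
  ... | yes refl = Pj
  ... | no j≢i   = subst P (punchIn-punchOut j≢i) (P-punchIn (punchOut j≢i))

  insertAt-nonneg : ∀ {n} (d : Fin n → ℝ) j t → Nonneg d → 0# ≤ t → Nonneg (insertAt d j t)
  insertAt-nonneg d j t 0≤d 0≤t = punchIn-cases j
    (subst (0# ≤_) (sym (insertAt-lookup d j t)) 0≤t)
    (λ i → subst (0# ≤_) (sym (insertAt-punchIn d j t i)) (0≤d i))

  -- Raise the coordinates from `d` to `e` one at a time; every vector on the way is nonnegative.
  -- The hypothesis on `≗` is there because the vectors to be identified agree only pointwise.
  monotone-coordinatewise : ∀ {n} (f : (Fin n → ℝ) → ℝ) →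
    (∀ {d e} → d ≗ e → f d ≡ f e) →
    (∀ d e j → Nonneg d → d j ≤ e j → (∀ i → ¬ (i ≡ j) → e i ≡ d i) → f d ≤ f e) →
    ∀ d e → Nonneg d → (∀ i → d i ≤ e i) → f d ≤ f e
  monotone-coordinatewise {zero}  f ext step d e 0≤d d≤e = inj₂ (ext λ ())
  monotone-coordinatewise {suc n} f ext step d e 0≤d d≤e =
    ≤-trans (step d (e zero ∷ tail d) zero 0≤d (d≤e zero) λ { zero 0≢0 → contradiction refl 0≢0 ; (suc i) _ → refl })
    (≤-trans
      (monotone-coordinatewise (f ∘ (e zero ∷_)) (ext ∘ cons-cong)
        (λ d′ e′ j 0≤d′ d′ⱼ≤e′ⱼ e′≗d′ → step (e zero ∷ d′) (e zero ∷ e′) (suc j) (cons-nonneg 0≤d′) d′ⱼ≤e′ⱼ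
          λ { zero _ → refl ; (suc i) i≢j → e′≗d′ i (i≢j ∘ cong suc) })
        (tail d) (tail e) (0≤d ∘ suc) (d≤e ∘ suc))
      (inj₂ (ext λ { zero → refl ; (suc i) → refl })))
    where
    cons-cong : ∀ {x} {d′ e′ : Fin n → ℝ} → d′ ≗ e′ → (x ∷ d′) ≗ (x ∷ e′)
    cons-cong d′≗e′ zero    = refl
    cons-cong d′≗e′ (suc i) = d′≗e′ i
    cons-nonneg : ∀ {d′} → Nonneg d′ → Nonneg (e zero ∷ d′)
    cons-nonneg 0≤d′ zero    = ≤-trans (0≤d zero) (d≤e zero)
    cons-nonneg 0≤d′ (suc i) = 0≤d′ i

  difference : ∀ x y → y ≡ x + (y + - x)
  difference x y = sym (begin
    x + (y + - x)   ≡⟨ cong (x +_) (+-comm y (- x)) ⟩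
    x + (- x + y)   ≡⟨ +-assoc x (- x) y ⟨
    x + - x + y     ≡⟨ cong (_+ y) (-‿inverseʳ x) ⟩
    0# + y          ≡⟨ +-identityˡ y ⟩
    y               ∎)
    where open ≡-Reasoning

  x<y⇒0<y-x : ∀ {x y} → x < y → 0# < y + - x
  x<y⇒0<y-x {x} x<y = subst (_< _) (-‿inverseʳ x) (+-mono-< (- x) x<y)

  x≤y⇒0≤y-x : ∀ {x y} → x ≤ y → 0# ≤ y + - x
  x≤y⇒0≤y-x (inj₁ x<y)  = inj₁ (x<y⇒0<y-x x<y)
  x≤y⇒0≤y-x {x} (inj₂ refl) = inj₂ (sym (-‿inverseʳ x))

  -- The partial derivative of det (A ⊕ d) in d j is det (minor j j A ⊕ d).
  PositiveSlopes : ∀ {n} → Mat R (suc n) → Set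
  PositiveSlopes A = ∀ j d → Nonneg d → 0# < det R (minor j j A ⊕ d)

  det-⊕-mono-≤ : ∀ {n} (A : Mat R (suc n)) → PositiveSlopes A →
    ∀ d e → Nonneg d → (∀ i → d i ≤ e i) → det R (A ⊕ d) ≤ det R (A ⊕ e)
  det-⊕-mono-≤ A slopes = monotone-coordinatewise (λ d → det R (A ⊕ d)) (det-⊕-cong A)
    λ d e j 0≤d dⱼ≤eⱼ e≗d → subst (det R (A ⊕ d) ≤_)
      (sym (det-⊕-shift A j d e (e j + - d j) (difference (d j) (e j)) (λ i → e≗d (punchIn j i) (punchInᵢ≢i j i))))
      (x≤x+y _ (*-nonneg (x≤y⇒0≤y-x dⱼ≤eⱼ) (inj₁ (slopes j (d ∘ punchIn j) (0≤d ∘ punchIn j)))))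

  -- Pick a coordinate where `d` and `e` differ. Raising it alone gives a strict increase, and
  -- raising the others afterwards loses nothing.
  det-⊕-mono-< : ∀ {n} (A : Mat R (suc n)) → PositiveSlopes A →
    ∀ d e → Nonneg d → (∀ i → d i ≤ e i) → ¬ (d ≗ e) → det R (A ⊕ d) < det R (A ⊕ e)
  det-⊕-mono-< {n} A slopes d e 0≤d d≤e d≢e with ¬∀⟶∃¬ (suc n) _ (λ i → d i ≟ᵣ e i) d≢e
  ... | j , dⱼ≢eⱼ with d≤e j
  ...   | inj₂ dⱼ≡eⱼ = contradiction dⱼ≡eⱼ dⱼ≢eⱼ
  ...   | inj₁ dⱼ<eⱼ = <-≤-trans
    (subst (det R (A ⊕ d) <_)
      (sym (det-⊕-shift A j d (insertAt d′ j (e j)) (e j + - d j)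
        (trans (insertAt-lookup d′ j (e j)) (difference (d j) (e j)))
        (insertAt-punchIn d′ j (e j))))
      (x<x+y _ (*-pos (x<y⇒0<y-x dⱼ<eⱼ) (slopes j d′ (0≤d ∘ punchIn j)))))
    (det-⊕-mono-≤ A slopes (insertAt d′ j (e j)) e
      (insertAt-nonneg d′ j (e j) (0≤d ∘ punchIn j) (≤-trans (0≤d j) (d≤e j)))
      (punchIn-cases j
        (inj₂ (insertAt-lookup d′ j (e j)))
        (λ i → subst (_≤ e (punchIn j i)) (sym (insertAt-punchIn d′ j (e j) i)) (d≤e (punchIn j i)))))
    where d′ = d ∘ punchIn j

  -- Principal minors

  -- Index sets are reached by deleting one index at a time, down to the empty one. A minor may be
  -- reached along several routes, but this form suits induction on the size.
  PrincipalMinors : ∀ {n} → (ℝ → Set) → Mat R n → Set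
  PrincipalMinors {zero}  P A = P (det R A)
  PrincipalMinors {suc n} P A = P (det R A) × (∀ i → PrincipalMinors P (minor i i A))

  fullMinor : ∀ {n P} {A : Mat R n} → PrincipalMinors P A → P (det R A)
  fullMinor {zero}  p = p
  fullMinor {suc n} p = proj₁ p

  punchIn-mono-< : ∀ {n} i (j k : Fin n) → j Fin.< k → punchIn i j Fin.< punchIn i k
  punchIn-mono-< i j k j<k = ℕ.≰⇒> λ p → ℕ.<⇒≱ j<k (punchIn-cancel-≤ i k j p)

  punchIn-cancel-< : ∀ {n} i (j k : Fin n) → punchIn i j Fin.< punchIn i k → j Fin.< k
  punchIn-cancel-< i j k p<q = ℕ.≰⇒> λ k≤j → ℕ.<⇒≱ p<q (punchIn-mono-≤ i k j k≤j)

  ∀increasing⇒PrincipalMinors : ∀ {n P} (A : Mat R n) →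
    (∀ k (σ : Fin k → Fin n) → StrictlyIncreasing R σ → P (det R (principalSub R A σ))) →
    PrincipalMinors P A
  ∀increasing⇒PrincipalMinors {zero}  A h = h zero (λ i → i) (λ _ _ a<b → a<b)
  ∀increasing⇒PrincipalMinors {suc n} A h =
    h (suc n) (λ i → i) (λ _ _ a<b → a<b) ,
    λ i → ∀increasing⇒PrincipalMinors (minor i i A) λ k σ σ↑ →
      h k (punchIn i ∘ σ) (λ a b a<b → punchIn-mono-< i (σ a) (σ b) (σ↑ a b a<b))

  -- The index set of `σ` omits `i`, so its principal submatrix is already one of `minor i i A`.
  FactorsThrough : ∀ {k n} → Fin (suc n) → (Fin k → Fin (suc n)) → Set
  FactorsThrough {k} {n} i σ =
    Σ (Fin k → Fin n) λ τ → StrictlyIncreasing R τ × (∀ a → punchIn i (τ a) ≡ σ a)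

  avoids⇒FactorsThrough : ∀ {k n} (i : Fin (suc n)) (σ : Fin k → Fin (suc n)) →
    StrictlyIncreasing R σ → (∀ a → ¬ (i ≡ σ a)) → FactorsThrough i σ
  avoids⇒FactorsThrough i σ σ↑ i∉σ = τ , τ↑ , λ a → punchIn-punchOut (i∉σ a)
    where
    τ = λ a → punchOut (i∉σ a)
    τ↑ : StrictlyIncreasing R τ
    τ↑ a b a<b = punchIn-cancel-< i (τ a) (τ b)
      (subst₂ Fin._<_ (sym (punchIn-punchOut (i∉σ a))) (sym (punchIn-punchOut (i∉σ b))) (σ↑ a b a<b))

  -- An index set is full or omits some index. If `σ zero` is not `zero`, then `zero` is omitted;
  -- otherwise strip it from both sides and recurse. Values are compared by `toℕ` since `Fin k` and
  -- `Fin (suc n)` are a priori different types.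
  identity-or-FactorsThrough : ∀ {k n} (σ : Fin k → Fin (suc n)) → StrictlyIncreasing R σ →
    (k ≡ suc n × (∀ a → toℕ (σ a) ≡ toℕ a)) ⊎ (∃ λ i → FactorsThrough i σ)
  identity-or-FactorsThrough {zero} σ σ↑ =
    inj₂ (zero , avoids⇒FactorsThrough zero σ σ↑ λ ())
  identity-or-FactorsThrough {suc k} {n} σ σ↑ with σ zero in σ₀
  ... | suc i = inj₂ (zero , avoids⇒FactorsThrough zero σ σ↑ avoids)
    where
    avoids : ∀ a → ¬ (zero ≡ σ a)
    avoids zero    0≡σa with () ← trans 0≡σa σ₀
    avoids (suc a) 0≡σa with () ← subst (σ zero Fin.<_) (sym 0≡σa) (σ↑ zero (suc a) (ℕ.s≤s ℕ.z≤n))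
  -- The later values of `σ` avoid `zero`; lowering them by one gives the `τ` of the recursion.
  ... | zero with avoids⇒FactorsThrough zero (σ ∘ suc) (λ a b a<b → σ↑ (suc a) (suc b) (ℕ.s≤s a<b))
                  (λ a 0≡σa → ℕ.<⇒≢ (σ↑ zero (suc a) (ℕ.s≤s ℕ.z≤n)) (cong toℕ (trans σ₀ 0≡σa)))
  identity-or-FactorsThrough {suc zero} {zero} σ σ↑ | zero | τ , τ↑ , σ≗ =
    inj₁ (refl , λ { zero → cong toℕ σ₀ })
  identity-or-FactorsThrough {suc (suc k)} {zero} σ σ↑ | zero | τ , τ↑ , σ≗ with () ← τ zero
  identity-or-FactorsThrough {suc k} {suc n} σ σ↑ | zero | τ , τ↑ , σ≗
    with identity-or-FactorsThrough τ τ↑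
  ... | inj₁ (refl , τ≗) = inj₁ (refl , λ
    { zero    → cong toℕ σ₀
    ; (suc a) → trans (cong toℕ (sym (σ≗ a))) (cong suc (τ≗ a)) })
  ... | inj₂ (i , ρ , ρ↑ , τ≗) = inj₂ (suc i , lift , lift↑ , λ
    { zero    → sym σ₀
    ; (suc a) → trans (cong suc (τ≗ a)) (σ≗ a) })
    where
    lift : Fin (suc k) → Fin (suc n)
    lift zero    = zero
    lift (suc a) = suc (ρ a)
    lift↑ : StrictlyIncreasing R lift
    lift↑ zero    (suc b) _           = ℕ.s≤s ℕ.z≤n
    lift↑ (suc a) (suc b) (ℕ.s≤s a<b) = ℕ.s≤s (ρ↑ a b a<b)

  PrincipalMinors⇒∀increasing : ∀ {n P} (A : Mat R n) → PrincipalMinors P A →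
    ∀ k (σ : Fin k → Fin n) → StrictlyIncreasing R σ → P (det R (principalSub R A σ))
  PrincipalMinors⇒∀increasing {zero}  A minors zero    σ σ↑ = minors
  PrincipalMinors⇒∀increasing {zero}  A minors (suc k) σ σ↑ with () ← σ zero
  PrincipalMinors⇒∀increasing {suc n} {P} A (full , minors) k σ σ↑ with identity-or-FactorsThrough σ σ↑
  ... | inj₁ (refl , σ≗) =
    subst P (det-cong λ a b → sym (cong₂ A (toℕ-injective (σ≗ a)) (toℕ-injective (σ≗ b)))) full
  ... | inj₂ (i , τ , τ↑ , σ≗) =
    subst P (det-cong λ a b → cong₂ A (σ≗ a) (σ≗ b))
      (PrincipalMinors⇒∀increasing (minor i i A) (minors i) k τ τ↑)

  -- Signs of principal minors and of perturbed determinants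

  -- Induction on the size: the slopes are perturbed determinants of smaller minors, hence positive,
  -- so the determinant does not fall below its value at zero perturbation.
  positiveMinors⇒det-⊕-pos : ∀ {n} (A : Mat R n) → PrincipalMinors (0# <_) A →
    ∀ d → Nonneg d → 0# < det R (A ⊕ d)
  positiveMinors⇒det-⊕-pos {zero}  A minors         d 0≤d = minors
  positiveMinors⇒det-⊕-pos {suc n} A (full , minors) d 0≤d =
    <-≤-trans (subst (0# <_) (sym (det-⊕-zero A)) full)
      (det-⊕-mono-≤ A (λ j → positiveMinors⇒det-⊕-pos (minor j j A) (minors j))
        (λ _ → 0#) d (λ _ → ≤-refl) 0≤d)

  -- With entry `i` of the perturbation growing without bound, the slope `det R (minor i i A ⊕ d)`
  -- cannot be negative. The minor thus inherits the hypothesis, and the argument recurs.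
  nonnegDet-⊕⇒nonnegMinors : ∀ {n} (A : Mat R n) → (∀ d → Nonneg d → 0# ≤ det R (A ⊕ d)) →
    PrincipalMinors (0# ≤_) A
  nonnegDet-⊕⇒nonnegMinors {zero}  A h = h (λ ()) (λ ())
  nonnegDet-⊕⇒nonnegMinors {suc n} A h =
    subst (0# ≤_) (det-⊕-zero A) (h (λ _ → 0#) (λ _ → ≤-refl)) ,
    λ i → nonnegDet-⊕⇒nonnegMinors (minor i i A) λ d 0≤d →
      affine-nonneg⇒slope-nonneg (det R (A ⊕ insertAt d i 0#)) (det R (minor i i A ⊕ d)) λ t 0≤t →
        subst (0# ≤_) (det-⊕-insertAt A i d t) (h (insertAt d i t) (insertAt-nonneg d i t 0≤d 0≤t))

  -- Cofactors and minors of Z-matrices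

  minor-IsZMatrix : ∀ {n} {A : Mat R (suc n)} → IsZMatrix R A → ∀ i → IsZMatrix R (minor i i A)
  minor-IsZMatrix Z i a b a≢b = Z (punchIn i a) (punchIn i b) (a≢b ∘ punchIn-injective i a b)

  -- Off the diagonal, expanding the minor without row j and column c along the row c of A
  -- leaves cofactors of minor c c A, weighted by off-diagonal entries of A.
  cofactor-offDiagonal : ∀ {n} (A : Mat R (suc (suc n))) c p →
    cofactor A (punchIn c p) c ≡ Σ[ (λ l → - (A c (punchIn c l) * cofactor (minor c c A) p l)) ]
  cofactor-offDiagonal {n} A c p = begin
    sg j * sg c * det R (minor j c A)
      ≡⟨ cong (sg j * sg c *_) (det-expand (minor j c A) q) ⟩
    sg j * sg c * Σ[ (λ l → minor j c A q l * cofactor (minor j c A) q l) ]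
      ≡⟨ *-sum {suc n} (sg j * sg c) (λ l → minor j c A q l * cofactor (minor j c A) q l) ⟩
    Σ[ (λ l → sg j * sg c * (minor j c A q l * cofactor (minor j c A) q l)) ]
      ≡⟨ sum-cong {suc n} term ⟩
    Σ[ (λ l → - (A c (punchIn c l) * cofactor (minor c c A) p l)) ] ∎
    where
    open ≡-Reasoning
    j = punchIn c p
    -- The position of row `c` once row `j` is deleted: row `q` of `minor j c A` is row `c` of `A`
    -- without its column `c`.
    q = other c p
    rearrange : ∀ j c a q l d → j * c * (a * (q * l * d)) ≡ j * q * (c * (a * (l * d)))
    rearrange = solve 6 (λ j c a q l d → j :* c :* (a :* (q :* l :* d)) := j :* q :* (c :* (a :* (l :* d)))) refl
    rearrange′ : ∀ c p a l d → c * p * (c * (a * (l * d))) ≡ c * c * (a * (p * l * d))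
    rearrange′ = solve 5 (λ c p a l d → c :* p :* (c :* (a :* (l :* d))) := c :* c :* (a :* (p :* l :* d))) refl
    term : ∀ l → sg j * sg c * (minor j c A q l * cofactor (minor j c A) q l) ≡
                 - (A c (punchIn c l) * cofactor (minor c c A) p l)
    term l = begin
      sg j * sg c * (A (punchIn j q) (punchIn c l) * (sg q * sg l * det R (minor q l (minor j c A))))
        ≡⟨ cong₂ (λ x y → sg j * sg c * (A x (punchIn c l) * (sg q * sg l * y))) (punchIn-other c p)
             (det-cong (λ x y → cong (λ z → A z (punchIn c (punchIn l y))) (punchIn-punchIn-other c p x))) ⟩
      sg j * sg c * (a * (sg q * sg l * d))
        ≡⟨ rearrange (sg j) (sg c) a (sg q) (sg l) d ⟩
      sg j * sg q * (sg c * (a * (sg l * d)))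
        ≡⟨ cong (_* (sg c * (a * (sg l * d)))) (sg-other c p) ⟩
      - (sg c * sg p) * (sg c * (a * (sg l * d)))
        ≡⟨ -‿distribˡ-* (sg c * sg p) _ ⟨
      - (sg c * sg p * (sg c * (a * (sg l * d))))
        ≡⟨ cong -_ (rearrange′ (sg c) (sg p) a (sg l) d) ⟩
      - (sg c * sg c * (a * (sg p * sg l * d)))
        ≡⟨ cong -_ (trans (cong (_* (a * (sg p * sg l * d))) (sg-square c)) (*-identityˡ _)) ⟩
      - (a * (sg p * sg l * d)) ∎
      where
      a = A c (punchIn c l)
      d = det R (minor p l (minor c c A))

  -- Diagonal cofactors are principal minors. An off-diagonal one is a sum of products of a negated
  -- off-diagonal entry, which is nonnegative, and a cofactor of a smaller Z-matrix, to which
  -- induction applies.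
  cofactor-nonneg : ∀ {n} (A : Mat R (suc n)) → IsZMatrix R A → PrincipalMinors (0# ≤_) A →
    ∀ r c → 0# ≤ cofactor A r c
  cofactor-nonneg {n} A Z (_ , minors) r c = punchIn-cases c {P = λ r → 0# ≤ cofactor A r c}
    (subst (0# ≤_) (sym (cofactor-diagonal A c)) (fullMinor {n} {0# ≤_} (minors c)))
    (offDiagonal A Z minors c) r
    where
    offDiagonal : ∀ {n} (A : Mat R (suc n)) → IsZMatrix R A →
      (∀ i → PrincipalMinors (0# ≤_) (minor i i A)) → ∀ c p → 0# ≤ cofactor A (punchIn c p) c
    offDiagonal {suc n} A Z minors c p = subst (0# ≤_) (sym (cofactor-offDiagonal A c p))
      (sum-nonneg {suc n} λ l → *-nonposˡ (Z c (punchIn c l) (punchInᵢ≢i c l ∘ sym))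
        (cofactor-nonneg (minor c c A) (minor-IsZMatrix Z c) (minors c) p l))

  -- If det (minor i i A) were 0, expanding along row i would leave only nonpositive terms.
  det-pos⇒minor-pos : ∀ {n} (A : Mat R (suc n)) → IsZMatrix R A → PrincipalMinors (0# ≤_) A →
    0# < det R A → ∀ i → 0# < det R (minor i i A)
  det-pos⇒minor-pos {n} A Z nonneg 0<det i with fullMinor {n} {0# ≤_} (proj₂ nonneg i)
  ... | inj₁ 0<minor = 0<minor
  ... | inj₂ 0≡minor = contradiction (subst (0# ≤_) -Σ≡-det (sum-nonneg {n} 0≤-term)) (<⇒≱ (pos⇒neg<0 0<det))
    where
    open ≡-Reasoning
    term : Fin n → ℝ
    term l = A i (punchIn i l) * cofactor A i (punchIn i l)
    0≤-term : ∀ l → 0# ≤ - term l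
    0≤-term l = *-nonposˡ (Z i (punchIn i l) (punchInᵢ≢i i l ∘ sym)) (cofactor-nonneg A Z nonneg i (punchIn i l))
    -Σ≡-det : Σ[ (λ l → - term l) ] ≡ - det R A
    -Σ≡-det = begin
      Σ[ (λ l → - term l) ]                              ≡⟨ neg-sum term ⟨
      - Σ[ term ]                                        ≡⟨ cong -_ (+-identityˡ _) ⟨
      - (0# + Σ[ term ])                                 ≡⟨ cong (λ z → - (z + Σ[ term ])) (zeroʳ (A i i)) ⟨
      - (A i i * 0# + Σ[ term ])                         ≡⟨ cong (λ z → - (A i i * z + Σ[ term ])) 0≡minor ⟩
      - (A i i * det R (minor i i A) + Σ[ term ])        ≡⟨ cong -_ (det-expand-diagonal A i) ⟨
      - det R A                                          ∎

  -- Positivity of the determinant descends through one deletion at a time by `det-pos⇒minor-pos`.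
  nonnegMinors⇒positiveMinors : ∀ {n} (A : Mat R n) → IsZMatrix R A → PrincipalMinors (0# ≤_) A →
    0# < det R A → PrincipalMinors (0# <_) A
  nonnegMinors⇒positiveMinors {zero}  A Z nonneg 0<det = 0<det
  nonnegMinors⇒positiveMinors {suc n} A Z nonneg 0<det = 0<det , λ i →
    nonnegMinors⇒positiveMinors (minor i i A) (minor-IsZMatrix Z i) (proj₂ nonneg i)
      (det-pos⇒minor-pos A Z nonneg 0<det i)

  -- Quasi non-singularity as positivity of slopes

  quasiNonsingular⇒PositiveSlopes : ∀ {n} (M : Mat R (suc n)) →
    IsQuasiNonsingularMMatrix R M → PositiveSlopes M
  quasiNonsingular⇒PositiveSlopes {n} M (_ , minors) j = positiveMinors⇒det-⊕-pos (minor j j M)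
    (∀increasing⇒PrincipalMinors (minor j j M) λ k σ σ↑ →
      -- An index set of `minor j j M` has at most `n` elements, so it is a proper one in `M`.
      minors k (ℕ.s≤s (increasing⇒≤ σ σ↑)) (punchIn j ∘ σ)
        (λ a b a<b → punchIn-mono-< j (σ a) (σ b) (σ↑ a b a<b)))
    where
    increasing⇒≤ : ∀ {k m} (σ : Fin k → Fin m) → StrictlyIncreasing R σ → k ℕ.≤ m
    increasing⇒≤ σ σ↑ = injective⇒≤ {f = σ} λ {a} {b} → injective a b
      where
      injective : ∀ a b → σ a ≡ σ b → a ≡ b
      injective a b σa≡σb with <-cmp a b
      ... | tri< a<b _ _ = contradiction (cong toℕ σa≡σb) (ℕ.<⇒≢ (σ↑ a b a<b))
      ... | tri≈ _ a≡b _ = a≡b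
      ... | tri> _ _ b<a = contradiction (cong toℕ (sym σa≡σb)) (ℕ.<⇒≢ (σ↑ b a b<a))

  -- A proper index set omits some `i`, so it suffices to treat the minors of `minor i i M`. All
  -- slopes together make these nonnegative, and the slope at zero perturbation makes the
  -- determinant of `minor i i M` positive.
  PositiveSlopes⇒quasiNonsingular : ∀ {n} (M : Mat R (suc n)) → IsZMatrix R M →
    PositiveSlopes M → IsQuasiNonsingularMMatrix R M
  PositiveSlopes⇒quasiNonsingular {n} M Z slopes = Z , properMinor
    where
    minors : ∀ j → PrincipalMinors (0# <_) (minor j j M)
    minors j = nonnegMinors⇒positiveMinors (minor j j M) (minor-IsZMatrix Z j)
      (nonnegDet-⊕⇒nonnegMinors (minor j j M) (λ d 0≤d → inj₁ (slopes j d 0≤d)))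
      (subst (0# <_) (det-⊕-zero (minor j j M)) (slopes j (λ _ → 0#) (λ _ → ≤-refl)))
    properMinor : ∀ k → k ℕ.< suc n → (σ : Fin k → Fin (suc n)) → StrictlyIncreasing R σ →
      0# < det R (principalSub R M σ)
    properMinor k k<1+n σ σ↑ with identity-or-FactorsThrough σ σ↑
    ... | inj₁ (k≡1+n , _) = contradiction k≡1+n (ℕ.<⇒≢ k<1+n)
    ... | inj₂ (i , τ , τ↑ , σ≗) = subst (0# <_) (det-cong λ a b → cong₂ M (σ≗ a) (σ≗ b))
      (PrincipalMinors⇒∀increasing (minor i i M) (minors i) k τ τ↑)

  -- Strict growth of the determinant as positivity of slopes

  DetIncreasing : ∀ {n} → Mat R n → Set
  DetIncreasing {n} M = (D D′ : Mat R n) → IsDiagonal R D → IsDiagonal R D′ →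
    _<M_ R (0M R) D′ → _<M_ R D′ D →
    (det R (_+M_ R M D′) < det R (_+M_ R M D)) × (det R M < det R (_+M_ R M D′))

  PositiveSlopes⇒DetIncreasing : ∀ {n} (M : Mat R (suc n)) → PositiveSlopes M → DetIncreasing M
  PositiveSlopes⇒DetIncreasing M slopes D D′ D-diag D′-diag (0≤D′ , 0≢D′) (D′≤D , D′≢D) =
    subst₂ _<_ (det-diagonal D′ D′-diag) (det-diagonal D D-diag)
      (det-⊕-mono-< M slopes d′ d (λ i → 0≤D′ i i) (λ i → D′≤D i i)
        λ d′≗d → D′≢D (diagonal-≗ D′ D D′-diag D-diag d′≗d)) ,
    subst₂ _<_ (det-⊕-zero M) (det-diagonal D′ D′-diag)
      (det-⊕-mono-< M slopes (λ _ → 0#) d′ (λ _ → ≤-refl) (λ i → 0≤D′ i i)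
        λ 0≗d′ → 0≢D′ (diagonal-≗ (0M R) D′ (λ _ _ _ → refl) D′-diag 0≗d′))
    where
    d = λ i → D i i
    d′ = λ i → D′ i i
    det-diagonal : ∀ E → IsDiagonal R E → det R (M ⊕ λ i → E i i) ≡ det R (_+M_ R M E)
    det-diagonal E E-diag = det-cong λ i k → cong (M i k +_) (sym (IsDiagonal⇒≡diag E-diag i k))
    diagonal-≗ : ∀ E F → IsDiagonal R E → IsDiagonal R F → (∀ i → E i i ≡ F i i) → ∀ i k → E i k ≡ F i k
    diagonal-≗ E F E-diag F-diag E≗F i k with i ≟ k
    ... | yes refl = E≗F i
    ... | no i≢k   = trans (E-diag i k i≢k) (sym (F-diag i k i≢k))

  DetIncreasing⇒det-⊕-< : ∀ {n} (M : Mat R n) → DetIncreasing M →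
    ∀ d d′ → Nonneg d′ → ¬ (∀ i → d′ i ≡ 0#) → (∀ i → d′ i ≤ d i) → ¬ (d′ ≗ d) →
    (det R (M ⊕ d′) < det R (M ⊕ d)) × (det R M < det R (M ⊕ d′))
  DetIncreasing⇒det-⊕-< M increasing d d′ 0≤d′ d′≢0 d′≤d d′≢d =
    increasing (diag d) (diag d′) (λ i k → diag-≢ d) (λ i k → diag-≢ d′)
      ((λ i k → subst (_≤ diag d′ i k) (diag-zero i k) (diag-mono (λ _ → 0#) d′ 0≤d′ i k)) ,
       λ 0≗d′ → d′≢0 λ i → trans (sym (diag-≡ d′ i)) (sym (0≗d′ i i)))
      (diag-mono d′ d d′≤d ,
       λ d′≗d → d′≢d λ i → trans (sym (diag-≡ d′ i)) (trans (d′≗d i i) (diag-≡ d i)))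
    where
    diag-mono : ∀ e f → (∀ i → e i ≤ f i) → ∀ i k → diag e i k ≤ diag f i k
    diag-mono e f e≤f i k with i ≟ k
    ... | yes _ = e≤f i
    ... | no  _ = ≤-refl

  -- By the affine law the slope is the increment of the determinant as the entry inserted at `j`
  -- goes from `0#` to `1#`.
  DetIncreasing⇒PositiveSlopes : ∀ {n} (M : Mat R (suc n)) → DetIncreasing M → PositiveSlopes M
  DetIncreasing⇒PositiveSlopes {n} M increasing j d 0≤d =
    cancel (subst (det R (M ⊕ e 0#) <_)
      (trans (det-⊕-insertAt M j d 1#) (cong (det R (M ⊕ e 0#) +_) (*-identityˡ _))) step)
    where
    e : ℝ → Fin (suc n) → ℝ
    e = insertAt d j
    0≤1 : 0# ≤ 1#
    0≤1 = inj₁ 0<1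
    cancel : ∀ {x y} → x < x + y → 0# < y
    cancel {x} {y} x<x+y′ = subst₂ _<_ (-‿inverseˡ x)
      (trans (sym (+-assoc (- x) x y)) (trans (cong (_+ y) (-‿inverseˡ x)) (+-identityˡ y)))
      (+-monoʳ-< (- x) x<x+y′)
    e-mono : ∀ {s t} → s ≤ t → ∀ i → e s i ≤ e t i
    e-mono {s} {t} s≤t = punchIn-cases j
      (subst₂ _≤_ (sym (insertAt-lookup d j s)) (sym (insertAt-lookup d j t)) s≤t)
      (λ i → inj₂ (trans (insertAt-punchIn d j s i) (sym (insertAt-punchIn d j t i))))
    e-injective : ∀ {s t} → e s ≗ e t → s ≡ t
    e-injective {s} {t} es≗et =
      trans (sym (insertAt-lookup d j s)) (trans (es≗et j) (insertAt-lookup d j t))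
    -- D′ must be nonzero, so when e 0# vanishes e 1# takes its place and the comparison is with M itself.
    step : det R (M ⊕ e 0#) < det R (M ⊕ e 1#)
    step with all? (λ i → e 0# i ≟ᵣ 0#)
    ... | no e≢0 = proj₁ (DetIncreasing⇒det-⊕-< M increasing (e 1#) (e 0#)
            (insertAt-nonneg d j 0# 0≤d ≤-refl) e≢0 (e-mono 0≤1) (0≢1 ∘ e-injective))
    ... | yes e≗0 = subst (_< det R (M ⊕ e 1#)) (sym (trans (det-⊕-cong M e≗0) (det-⊕-zero M)))
            (proj₂ (DetIncreasing⇒det-⊕-< M increasing (e (1# + 1#)) (e 1#)
              (insertAt-nonneg d j 1# 0≤d 0≤1)
              (λ e1≗0 → 0≢1 (trans (sym (e1≗0 j)) (insertAt-lookup d j 1#)))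
              (e-mono (x≤x+y 1# 0≤1))
              (λ e1≗e2 → <-irrefl (e-injective e1≗e2) (x<x+y 1# 0<1))))

theorem2p14 : (R : RealField) (n : ℕ) (M : Mat R n) → IsZMatrix R M →
    (IsQuasiNonsingularMMatrix R M ⇔
    ((D D′ : Mat R n) → IsDiagonal R D → IsDiagonal R D′ →
    _<M_ R (0M R) D′ → _<M_ R D′ D →
    (RealField._<_ R (det R (_+M_ R M D′)) (det R (_+M_ R M D)) ×
    RealField._<_ R (det R M) (det R (_+M_ R M D′)))))
theorem2p14 R zero M Z = mk⇔
  -- All matrices of size zero coincide, so no `D′` lies strictly above `0M`; nor is there a proper
  -- index set. Both sides hold vacuously.
  (λ { _ D D′ _ _ (_ , 0≢D′) _ → contradiction (λ ()) 0≢D′ })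
  (λ _ → Z , λ _ ())
theorem2p14 R (suc n) M Z = mk⇔
  (PositiveSlopes⇒DetIncreasing R M ∘ quasiNonsingular⇒PositiveSlopes R M)
  (PositiveSlopes⇒quasiNonsingular R M Z ∘ DetIncreasing⇒PositiveSlopes R M)
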